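{- Let $n>k>t>j\ge1$ be integers with $n\ge(k-t+1)(t+1)$ and $t+2\le k-t+1$. Suppose that $\mathcal F\subset\binom{[n]}{k}$ is shifted and $t$-intersecting, and $\mathcal F\not\subset\mathcal A_1$. If $$|\mathcal F|>t\binom{n-2k+t}{k-t-1}+\sum_{t+2\le\ell\le k}\binom{2k-t}{\ell-t}\binom{n}{k-\ell},$$ then $$|\partial^j\mathcal F|>\binom{t}{j}|\mathcal F|.$$
   Context: $[n]=\{1,\dots,n\}$, and $\binom{[n]}{k}$ is the collection of all $k$-element subsets of $[n]$. A family $\mathcal F\subset\binom{[n]}{k}$ is $t$-intersecting if $|F\cap F'|\ge t$ for all $F,F'\in\mathcal F$. The $j$'th shadow is $\partial^j\mathcal F=\{G\in\binom{[n]}{k-j} : \exists F\in\mathcal F,\ G\subset F\}$. Shifted: for $k$-sets $A=\{a_1<\dots<a_k\}$, $B=\{b_1<\dots<b_k\}$ write $A\prec B$ iff $a_i\le b_i$ for all $1\le i\le k$; $\mathcal F$ is shifted if $A\prec B$ and $B\in\mathcal F$ always imply $A\in\mathcal F$. $\mathcal A_1=\{A\in\binom{[n]}{k}: |A\cap[t+2]|\ge t+1\}$. -}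

module Defs where

open import Data.Bool using (true; false)
open import Data.Fin using (Fin; toℕ)
import Data.Fin as Fin
open import Data.Fin.Subset using (Subset; _∩_; _⊆_; ∣_∣)
open import Data.Fin.Subset.Properties using (_∈?_; _⊆?_; anySubset?)
open import Data.List using (List; []; _∷_; _++_; map; filter; length; upTo; allFin)
open import Data.List.Relation.Binary.Pointwise using (Pointwise)
open import Data.Nat using (ℕ; zero; suc; _+_; _∸_; _≤_; _≟_; _<?_)
open import Data.Nat.ListAction using (sum)
open import Data.Product using (_×_; ∃-syntax)
import Data.Vec as Vec
open import Level using (0ℓ)
open import Relation.Binary.PropositionalEquality using (_≡_)
open import Relation.Nullary using (does)
open import Relation.Nullary.Decidable using (_×-dec_)
open import Relation.Unary using (Pred; Decidable)

-- The ground set {1,…,n} is represented by Fin n, with i : Fin n standing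
-- for the element toℕ i + 1.

Family : ℕ → Set₁
Family n = Pred (Subset n) 0ℓ

[_] : ∀ {n} → ℕ → Subset n
[ m ] = Vec.tabulate (λ i → does (toℕ i <? m))

binom : ∀ {n} → ℕ → Family n
binom k A = ∣ A ∣ ≡ k

allSubsets : ∀ n → List (Subset n)
allSubsets zero    = Vec.[] ∷ []
allSubsets (suc n) =
  map (true Vec.∷_) (allSubsets n) ++ map (false Vec.∷_) (allSubsets n)

-- Number of members of a family: allSubsets n lists every subset exactly once.
card : ∀ {n} {𝓕 : Family n} → Decidable 𝓕 → ℕ
card {n} 𝓕? = length (filter 𝓕? (allSubsets n))

Intersecting : ∀ {n} → ℕ → Family n → Set
Intersecting t 𝓕 = ∀ {A B} → 𝓕 A → 𝓕 B → t ≤ ∣ A ∩ B ∣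

-- In increasing order, because allFin n is increasing.
elements : ∀ {n} → Subset n → List (Fin n)
elements {n} A = filter (_∈? A) (allFin n)

-- Pointwise relates only lists of equal length, so A ≺ B entails ∣ A ∣ ≡ ∣ B ∣.
infix 4 _≺_
_≺_ : ∀ {n} → Subset n → Subset n → Set
A ≺ B = Pointwise Fin._≤_ (elements A) (elements B)

Shifted : ∀ {n} → Family n → Set
Shifted 𝓕 = ∀ {A B} → A ≺ B → 𝓕 B → 𝓕 A

-- The j-th shadow of a family of k-sets.
∂ : ∀ {n} → (k j : ℕ) → Family n → Family n
∂ k j 𝓕 G = binom (k ∸ j) G × (∃[ A ] 𝓕 A × G ⊆ A)

∂? : ∀ {n} (k j : ℕ) {𝓕 : Family n} → Decidable 𝓕 → Decidable (∂ k j 𝓕)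
∂? k j 𝓕? G = (∣ G ∣ ≟ k ∸ j) ×-dec anySubset? (λ A → 𝓕? A ×-dec (G ⊆? A))

𝓐₁ : ∀ {n} → (k t : ℕ) → Family n
𝓐₁ k t A = binom k A × t + 1 ≤ ∣ A ∩ [ t + 2 ] ∣

-- f a + f (a + 1) + … + f b, which is 0 when b < a.
∑[_⋯_] : ℕ → ℕ → (ℕ → ℕ) → ℕ
∑[ a ⋯ b ] f = sum (map (λ i → f (a + i)) (upTo (suc b ∸ a)))

{-# OPTIONS --safe #-}
module Submission where

-- Put M = 2k − t. By Frankl's lemma any two members A, B of 𝓕 satisfy
-- |A ∩ [i]| + |B ∩ [i]| ≥ i + t for some i ≤ M.
-- If some A ∈ 𝓕 has |A ∩ [M]| ≤ t + 1 and |A ∩ [2t]| ≤ t, then applying this to A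
-- and B shows that every B ∈ 𝓕 contains [t] or misses at most one element of
-- [2t + 1]. For such families there is an injection from 𝓕 × ([t] choose j) into
-- the shadow: (A , J) goes to A ∖ J when A ⊇ [t], and to an exchange of A otherwise.
-- The image does not contain [k − j], so the inequality is strict.
-- If there is no such A, then each A with |A ∩ [M]| ≤ t + 1 meets [M] in [t] and one
-- further element of [2t] (or misses an element of [t], which forces 𝓕 ⊆ 𝓐₁),
-- while for A with |A ∩ [M]| = ℓ ≥ t + 2 the lattice walk of A ∩ [M] reaches
-- height t, so the reflection principle leaves at most C(M, ℓ − t) traces.
-- Then |𝓕| is at most the assumed strict lower bound.

open import Defs
open import Algebra.Properties.CommutativeSemigroup using (interchange)
open import Data.Bool using (true; false; not; if_then_else_)
open import Data.Bool.Properties using (not-injective)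
open import Data.Empty using (⊥-elim)
open import Data.Fin using (Fin; zero; suc)
import Data.Fin as Fin
open import Data.Fin.Subset using (Subset; _∩_; ∣_∣; ⊤; ⊥; ∁)
import Data.Fin.Subset as Subset
open import Data.Fin.Subset.Properties
  using (_∈?_; anySubset?; ∣p∣≤n; ∣p∣≡n⇒p≡⊤; ∣⊤∣≡n; ∣⊥∣≡0; ∣∁p∣≡n∸∣p∣; ⊆-refl; ⊆⊤; out⊆; in⊆in; drop-∷-⊆)
open import Data.List using (List; []; _∷_; _++_; _∷ʳ_; map; filter; length; tabulate; allFin; upTo; cartesianProduct)
open import Data.List.Membership.Propositional using (_∈_)
open import Data.List.Membership.Propositional.Properties
  using (∈-∃++; ∈-++⁺ˡ; ∈-++⁺ʳ; ∈-++⁻; ∈-filter⁺; ∈-filter⁻; ∈-map⁺; ∈-map⁻; ∈-cartesianProduct⁻; ∈-upTo⁺)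
open import Data.List.Properties using (map-tabulate; map-∘; map-id; length-map; length-++; ++-assoc; filter-++)
open import Data.List.Relation.Binary.Pointwise using (Pointwise; []; _∷_)
open import Data.List.Relation.Unary.All as All using (All; []; _∷_)
import Data.List.Relation.Unary.All.Properties as All
open import Data.List.Relation.Unary.AllPairs using ([]; _∷_)
open import Data.List.Relation.Unary.Any using (here; there)
open import Data.List.Relation.Unary.Unique.Propositional using (Unique)
import Data.List.Relation.Unary.Unique.Propositional.Properties as Unique
open import Data.Nat using (ℕ; zero; suc; _+_; _*_; _∸_; _≤_; _<_; _>_; _≥_; z≤n; s≤s; _≟_; _≤?_; _<?_)
open import Data.Nat.Combinatorics using (_C_; nCn≡1; nC1≡n; nCk+nC[k+1]≡[n+1]C[k+1])
open import Data.Nat.ListAction using (sum)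
open import Data.Nat.Properties
open import Data.Product using (_×_; _,_; proj₁; proj₂; ∃-syntax; ∃₂)
open import Data.Sum using (_⊎_; inj₁; inj₂)
open import Data.Vec using ([]; _∷_)
import Data.Vec as Vec
import Data.Vec.Properties as Vec
open import Function using (_∘_; id)
open import Relation.Binary.Definitions using (tri<; tri≈; tri>)
open import Relation.Binary.PropositionalEquality
  using (_≡_; _≢_; refl; sym; trans; cong; cong₂; subst; subst₂; module ≡-Reasoning)
open import Relation.Nullary using (¬_; Dec; yes; no; does; contradiction)
open import Relation.Nullary.Decidable using (_×-dec_)
open import Relation.Unary using (Decidable; _⊆_)

private variable
  d e j m n q r t : ℕ
  P : Set

-- Initial segments and the shifting order

-- The recursive form of `∣ A ∩ [ i ] ∣`, which splits well along `Vec.++`; for i beyond n it stays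
-- at `∣ A ∣`.
rank : ℕ → Subset n → ℕ
rank zero    A           = 0
rank (suc i) []          = 0
rank (suc i) (true  ∷ A) = suc (rank i A)
rank (suc i) (false ∷ A) = rank i A

∣A∩[i]∣≡rank : ∀ i (A : Subset n) → ∣ A ∩ [ i ] ∣ ≡ rank i A
∣A∩[i]∣≡rank zero    []          = refl
∣A∩[i]∣≡rank zero    (true  ∷ A) = ∣A∩[i]∣≡rank zero A
∣A∩[i]∣≡rank zero    (false ∷ A) = ∣A∩[i]∣≡rank zero A
∣A∩[i]∣≡rank (suc i) []          = refl
∣A∩[i]∣≡rank (suc i) (true  ∷ A) = cong suc (∣A∩[i]∣≡rank i A)
∣A∩[i]∣≡rank (suc i) (false ∷ A) = ∣A∩[i]∣≡rank i A

rank≤i : ∀ i (A : Subset n) → rank i A ≤ i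
rank≤i zero    A           = z≤n
rank≤i (suc i) []          = z≤n
rank≤i (suc i) (true  ∷ A) = s≤s (rank≤i i A)
rank≤i (suc i) (false ∷ A) = m≤n⇒m≤1+n (rank≤i i A)

rank≤∣A∣ : ∀ i (A : Subset n) → rank i A ≤ ∣ A ∣
rank≤∣A∣ zero    A           = z≤n
rank≤∣A∣ (suc i) []          = z≤n
rank≤∣A∣ (suc i) (true  ∷ A) = s≤s (rank≤∣A∣ i A)
rank≤∣A∣ (suc i) (false ∷ A) = rank≤∣A∣ i A

rank-monoˡ-≤ : ∀ {i j} (A : Subset n) → i ≤ j → rank i A ≤ rank j A
rank-monoˡ-≤ A           z≤n       = z≤n
rank-monoˡ-≤ []          (s≤s i≤j) = z≤n
rank-monoˡ-≤ (true  ∷ A) (s≤s i≤j) = s≤s (rank-monoˡ-≤ A i≤j)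
rank-monoˡ-≤ (false ∷ A) (s≤s i≤j) = rank-monoˡ-≤ A i≤j

rank-+ : ∀ i p (A : Subset n) → rank (i + p) A ≤ rank i A + p
rank-+ zero    p A           = rank≤i p A
rank-+ (suc i) p []          = z≤n
rank-+ (suc i) p (true  ∷ A) = s≤s (rank-+ i p A)
rank-+ (suc i) p (false ∷ A) = rank-+ i p A

rank-++ˡ : (A : Subset m) (B : Subset n) → rank m (A Vec.++ B) ≡ ∣ A ∣
rank-++ˡ []          B = refl
rank-++ˡ (true  ∷ A) B = cong suc (rank-++ˡ A B)
rank-++ˡ (false ∷ A) B = rank-++ˡ A B

rank-++ : ∀ i (A : Subset m) (B : Subset n) → rank (m + i) (A Vec.++ B) ≡ ∣ A ∣ + rank i B
rank-++ i []          B = refl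
rank-++ i (true  ∷ A) B = cong suc (rank-++ i A B)
rank-++ i (false ∷ A) B = rank-++ i A B

rank-++-≤ : ∀ {i} → i ≤ m → (A : Subset m) (B : Subset n) → rank i (A Vec.++ B) ≡ rank i A
rank-++-≤ z≤n       A           B = refl
rank-++-≤ (s≤s i≤m) (true  ∷ A) B = cong suc (rank-++-≤ i≤m A B)
rank-++-≤ (s≤s i≤m) (false ∷ A) B = rank-++-≤ i≤m A B

∣++∣ : (A : Subset m) (B : Subset n) → ∣ A Vec.++ B ∣ ≡ ∣ A ∣ + ∣ B ∣
∣++∣ []          B = refl
∣++∣ (true  ∷ A) B = cong suc (∣++∣ A B)
∣++∣ (false ∷ A) B = ∣++∣ A B

-- Dominates 0 0 A B amounts to A ≺ B. In general the vectors are segments of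
-- longer ones: to the right of the segment B has e more elements than A, and
-- from its left end on B has d more elements than A.
data Dominates (e : ℕ) : ℕ → ∀ {n} → Subset n → Subset n → Set where
  []    : Dominates e e [] []
  keep  : ∀ {d n} {A B : Subset n} b → Dominates e d A B → Dominates e d (b ∷ A) (b ∷ B)
  late  : ∀ {d n} {A B : Subset n} → Dominates e d A B → Dominates e (suc d) (false ∷ A) (true ∷ B)
  early : ∀ {d n} {A B : Subset n} → Dominates e (suc d) A B → Dominates e d (true ∷ A) (false ∷ B)

Dominates-refl : (A : Subset n) → Dominates e e A A
Dominates-refl []      = []
Dominates-refl (b ∷ A) = keep b (Dominates-refl A)

Dominates-++ : ∀ {c} {A B : Subset m} {A′ B′ : Subset n} →
  Dominates c d A B → Dominates e c A′ B′ → Dominates e d (A Vec.++ A′) (B Vec.++ B′)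
Dominates-++ []         q = q
Dominates-++ (keep b p) q = keep b (Dominates-++ p q)
Dominates-++ (late p)   q = late (Dominates-++ p q)
Dominates-++ (early p)  q = early (Dominates-++ p q)

elements-∷ : ∀ b (A : Subset n) →
  filter (_∈? (b ∷ A)) (tabulate suc) ≡ map suc (elements A)
elements-∷ {n} b A = trans (cong (filter (_∈? (b ∷ A))) (sym (map-tabulate id suc))) (filter-suc (allFin n))
  where
  filter-suc : ∀ xs → filter (_∈? (b ∷ A)) (map suc xs) ≡ map suc (filter (_∈? A) xs)
  filter-suc []       = refl
  filter-suc (x ∷ xs) with does (x ∈? A)
  ... | true  = cong (suc x ∷_) (filter-suc xs)
  ... | false = filter-suc xs

-- Here f accumulates the shifts by `suc`, so that structural recursion on A can replace the
-- filtering of `allFin` in `elements`.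
elementsBy : ∀ {N} → (Fin n → Fin N) → Subset n → List (Fin N)
elementsBy f []          = []
elementsBy f (true  ∷ A) = f zero ∷ elementsBy (f ∘ suc) A
elementsBy f (false ∷ A) = elementsBy (f ∘ suc) A

map-elements : ∀ {N} (f : Fin n → Fin N) (A : Subset n) → map f (elements A) ≡ elementsBy f A
map-elements f []          = refl
map-elements f (true  ∷ A) = cong (f zero ∷_)
  (trans (cong (map f) (elements-∷ true A)) (trans (sym (map-∘ (elements A))) (map-elements (f ∘ suc) A)))
map-elements f (false ∷ A) =
  trans (cong (map f) (elements-∷ false A)) (trans (sym (map-∘ (elements A))) (map-elements (f ∘ suc) A))

-- A deficit of d is made up by a list xs of d smaller elements.
Dominates⇒Pointwise : ∀ {N} {A B : Subset n} → Dominates 0 d A B →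
  (f : Fin n → Fin N) → (∀ {i j} → i Fin.≤ j → f i Fin.≤ f j) →
  (xs : List (Fin N)) → length xs ≡ d → All (λ x → ∀ i → x Fin.≤ f i) xs →
  Pointwise Fin._≤_ (xs ++ elementsBy f A) (elementsBy f B)
Dominates⇒Pointwise [] f f-mono [] refl [] = []
Dominates⇒Pointwise (keep false p) f f-mono xs len xs≤ =
  Dominates⇒Pointwise p (f ∘ suc) (f-mono ∘ s≤s) xs len (All.map (_∘ suc) xs≤)
Dominates⇒Pointwise (keep true p) f f-mono [] len [] =
  ≤-refl ∷ Dominates⇒Pointwise p (f ∘ suc) (f-mono ∘ s≤s) [] len []
-- The list is a queue: its first entry x is matched with the present element of B, and the present
-- element of A joins at the end.
Dominates⇒Pointwise (keep {A = A} true p) f f-mono (x ∷ xs) len (x≤ ∷ xs≤)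
  rewrite sym (++-assoc xs (f zero ∷ []) (elementsBy (f ∘ suc) A))
  = x≤ zero ∷ Dominates⇒Pointwise p (f ∘ suc) (f-mono ∘ s≤s) (xs ∷ʳ f zero)
      (trans (length-++ xs) (trans (+-comm _ 1) len))
      (All.++⁺ (All.map (_∘ suc) xs≤) ((λ i → f-mono z≤n) ∷ []))
Dominates⇒Pointwise (late p) f f-mono (x ∷ xs) len (x≤ ∷ xs≤) =
  x≤ zero ∷ Dominates⇒Pointwise p (f ∘ suc) (f-mono ∘ s≤s) xs (suc-injective len) (All.map (_∘ suc) xs≤)
Dominates⇒Pointwise (early {A = A} p) f f-mono xs len xs≤
  rewrite sym (++-assoc xs (f zero ∷ []) (elementsBy (f ∘ suc) A))
  = Dominates⇒Pointwise p (f ∘ suc) (f-mono ∘ s≤s) (xs ∷ʳ f zero)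
      (trans (length-++ xs) (trans (+-comm _ 1) (cong suc len)))
      (All.++⁺ (All.map (_∘ suc) xs≤) ((λ i → f-mono z≤n) ∷ []))

Dominates⇒≺ : {A B : Subset n} → Dominates 0 0 A B → A ≺ B
Dominates⇒≺ {A = A} {B} p = subst₂ (Pointwise Fin._≤_) (elementsBy-id A) (elementsBy-id B)
  (Dominates⇒Pointwise p id id [] refl [])
  where
  elementsBy-id : ∀ A → elementsBy id A ≡ elements A
  elementsBy-id A = trans (sym (map-elements id A)) (map-id (elements A))

-- Each element of `[ m ]` coincides with an element of A or comes early; the rest of A is late.
-- With d = 0 this puts `[ k ]` into every nonempty shifted family of k-sets.
initial-Dominates : ∀ m (A : Subset n) → m + d ≡ ∣ A ∣ → Dominates 0 d [ m ] A
initial-Dominates zero    [] refl = []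
initial-Dominates {d = suc d} zero    (true  ∷ A) eq = late (initial-Dominates zero A (suc-injective eq))
initial-Dominates zero    (false ∷ A) eq = keep false (initial-Dominates zero A eq)
initial-Dominates (suc m) (true  ∷ A) eq = keep true (initial-Dominates m A (suc-injective eq))
initial-Dominates (suc m) (false ∷ A) eq = early (initial-Dominates m A (trans (+-suc m _) eq))

-- A′ keeps the first e common elements of A and B, drops the others, and
-- replaces each of them by an earlier element outside A ∪ B; d of the dropped
-- elements find no replacement.
avoid : ∀ e (A B : Subset n) → ∃[ d ] ∃[ A′ ] Dominates 0 d A′ A × ∣ A′ ∩ B ∣ ≤ e ×
  (d ≡ 0 ⊎ (∃[ i ] i + (e + d) ≤ rank i A + rank i B))
avoid e [] [] = 0 , [] , [] , z≤n , inj₁ refl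
avoid e (true ∷ A) (false ∷ B) with avoid e A B
... | d , A′ , p , q , inj₁ d≡0 = d , true ∷ A′ , keep true p , q , inj₁ d≡0
... | d , A′ , p , q , inj₂ (i , r) = d , true ∷ A′ , keep true p , q , inj₂ (suc i , s≤s r)
avoid e (false ∷ A) (true ∷ B) with avoid e A B
... | d , A′ , p , q , inj₁ d≡0 = d , false ∷ A′ , keep false p , q , inj₁ d≡0
... | d , A′ , p , q , inj₂ (i , r) = d , false ∷ A′ , keep false p , q ,
  inj₂ (suc i , subst (suc (i + (e + d)) ≤_) (sym (+-suc _ _)) (s≤s r))
avoid zero (true ∷ A) (true ∷ B) with avoid zero A B
-- This common element is the only one without replacement; the prefix of length 1 is a witness,
-- since 1 + (0 + 1) = 1 + 1.
... | d , A′ , p , q , inj₁ refl = 1 , false ∷ A′ , late p , q , inj₂ (1 , s≤s (≤-reflexive refl))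
... | d , A′ , p , q , inj₂ (i , r) = suc d , false ∷ A′ , late p , q ,
  inj₂ (suc i , subst₂ (λ x y → suc x ≤ suc y) (sym (+-suc i d)) (sym (+-suc _ _)) (s≤s (s≤s r)))
avoid (suc e) (true ∷ A) (true ∷ B) with avoid e A B
... | d , A′ , p , q , inj₁ d≡0 = d , true ∷ A′ , keep true p , s≤s q , inj₁ d≡0
... | d , A′ , p , q , inj₂ (i , r) = d , true ∷ A′ , keep true p , s≤s q ,
  inj₂ (suc i , subst₂ (λ x y → suc x ≤ suc y) (sym (+-suc i _)) (sym (+-suc _ _)) (s≤s (s≤s r)))
avoid e (false ∷ A) (false ∷ B) with avoid e A B
... | zero , A′ , p , q , _ = 0 , false ∷ A′ , keep false p , q , inj₁ refl
... | suc zero , A′ , p , q , _ = 0 , true ∷ A′ , early p , q , inj₁ refl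
-- A position outside both sets replaces one dropped element: i grows by one, d falls by one, and
-- the bound is unchanged.
... | suc (suc d) , A′ , p , q , inj₂ (i , r) = suc d , true ∷ A′ , early p , q ,
  inj₂ (suc i , subst (_≤ rank i A + rank i B) (trans (cong (i +_) (+-suc e (suc d))) (+-suc i _)) r)

-- Frankl's lemma on shifted t-intersecting families.
prefix-intersection : ∀ t {𝓕 : Family n} → Shifted 𝓕 → Intersecting t 𝓕 →
  ∀ {A B} → 𝓕 A → 𝓕 B → ∃[ i ] i + t ≤ rank i A + rank i B
prefix-intersection zero    shifted int _ _ = 0 , z≤n
prefix-intersection (suc e) shifted int {A} {B} A∈ B∈ with avoid e A B
-- For d = 0 the set A′ would be a member meeting B in at most e < t elements. Hence d ≥ 1, and then
-- e + d ≥ t.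
... | d , A′ , p , q , inj₁ refl = contradiction (int (shifted (Dominates⇒≺ p) A∈) B∈) (<⇒≱ (s≤s q))
... | zero , A′ , p , q , inj₂ _ = contradiction (int (shifted (Dominates⇒≺ p) A∈) B∈) (<⇒≱ (s≤s q))
... | suc d , A′ , p , q , inj₂ (i , r) = i , ≤-trans (+-monoʳ-≤ i (≤-trans (s≤s (m≤m+n e d)) (≤-reflexive (sym (+-suc e d))))) r

-- Members with a small trace on [2k − t]

meeting-point-≤ : ∀ {k t i} {A B : Subset n} → ∣ A ∣ ≡ k → ∣ B ∣ ≡ k →
  i + t ≤ rank i A + rank i B → i ≤ 2 * k ∸ t
meeting-point-≤ {i = i} {A} {B} refl ∣B∣≡k meet = m+n≤o⇒m≤o∸n i (≤-trans meet (+-mono-≤ (rank≤∣A∣ i A)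
  (≤-trans (rank≤∣A∣ i B) (≤-reflexive (trans ∣B∣≡k (sym (+-identityʳ _)))))))

-- What the injection into the shadow needs: A contains [t] or has at most one gap in [2t + 1].
NearStar : ℕ → Subset n → Set
NearStar t A = t ≤ rank t A ⊎ t + t ≤ rank (t + suc t) A

module _ {k t} {A B : Subset n} (∣A∣≡k : ∣ A ∣ ≡ k) (∣B∣≡k : ∣ B ∣ ≡ k) (A-short : rank (2 * k ∸ t) A ≤ suc t) where

  private
    short : ∀ {i} → i + t ≤ rank i A + rank i B → rank i A ≤ suc t
    short {i} meet = ≤-trans (rank-monoˡ-≤ A (meeting-point-≤ {t = t} {i} {A} {B} ∣A∣≡k ∣B∣≡k meet)) A-short

    t≤rank : ∀ {i} → i + t ≤ rank i A + rank i B → t ≤ rank i A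
    t≤rank {i} meet = +-cancelʳ-≤ i t (rank i A) (≤-trans (≤-reflexive (+-comm t i)) (≤-trans meet (+-monoʳ-≤ _ (rank≤i i B))))

    -- A supplies at most c + t of the required i + t, so B has at most c gaps in [i]. The next
    -- lemma passes to a shorter prefix, which has no more gaps.
    nearly-full : ∀ {i c} → i + t ≤ rank i A + rank i B → rank i A ≤ c + t → i ≤ rank i B + c
    nearly-full {i} {c} meet rank≤ = +-cancelʳ-≤ t i (rank i B + c) (≤-trans meet (≤-trans (+-monoˡ-≤ _ rank≤)
      (≤-reflexive (trans (+-comm (c + t) _) (sym (+-assoc (rank i B) c t))))))

    nearly-full-≤ : ∀ {h i c} → h ≤ i → i ≤ rank i B + c → h ≤ rank h B + c
    nearly-full-≤ {h} {i} {c} h≤i full with m≤n⇒∃[o]m+o≡n h≤i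
    ... | p , refl = +-cancelʳ-≤ p h (rank h B + c) (≤-trans full (≤-trans (+-monoˡ-≤ c (rank-+ h p B))
      (≤-reflexive (trans (+-assoc (rank h B) p c) (trans (cong (rank h B +_) (+-comm p c)) (sym (+-assoc (rank h B) c p)))))))

    nearly-full-suc : ∀ {h i} → suc h ≤ i → i ≤ rank i B + 1 → h ≤ rank (suc h) B
    nearly-full-suc {h} h<i full = ≤-pred (≤-trans (nearly-full-≤ h<i full) (≤-reflexive (+-comm _ 1)))

  -- If i ≤ 2t, then A has at most t elements in [i], so B is full on [i], and i ≥ t. If i > 2t,
  -- then A has at most t + 1, so B has at most one gap in [i].
  short⇒NearStar : (∃[ i ] i + t ≤ rank i A + rank i B) → rank (t + t) A ≤ t →
    NearStar t B
  short⇒NearStar (i , meet) rank≤t with i ≤? t + t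
  ... | yes i≤2t = inj₁ (subst (t ≤_) (+-identityʳ _) (nearly-full-≤ (≤-trans (t≤rank meet) (rank≤i i A))
                     (nearly-full meet (≤-trans (rank-monoˡ-≤ A i≤2t) rank≤t))))
  ... | no  i≰2t rewrite +-suc t t = inj₂ (nearly-full-suc (≰⇒> i≰2t) (nearly-full meet (short meet)))

  -- A has at least t elements in [i], so i > t. For i = t + 1 the gap of A in [t] makes B full on
  -- [t + 1]; for larger i, B has at most one gap in [t + 2].
  short⇒𝓐₁ : (∃[ i ] i + t ≤ rank i A + rank i B) → rank t A < t → suc t ≤ rank (suc (suc t)) B
  short⇒𝓐₁ (i , meet) rank<t with <-cmp i (suc t)
  ... | tri< (s≤s i≤t) _ _ = contradiction (≤-trans (t≤rank meet) (rank-monoˡ-≤ A i≤t)) (<⇒≱ rank<t)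
  ... | tri> _ _ i>1+t = nearly-full-suc i>1+t (nearly-full meet (short meet))
  ... | tri≈ _ refl _ = ≤-trans (subst (suc t ≤_) (+-identityʳ _) (nearly-full meet rank≤t)) (rank-monoˡ-≤ B (n≤1+n _))
    where
    rank≤t : rank (suc t) A ≤ t
    rank≤t = subst (λ h → rank h A ≤ t) (+-comm t 1)
      (≤-trans (rank-+ t 1 A) (≤-trans (≤-reflexive (+-comm _ 1)) rank<t))

-- Injections into the shadow

module _ {A B : Set} (_∼_ : A → B → Set) where

  -- The two bounds are proved together: once the head of `xs` takes y, injectivity keeps the tail
  -- away from y, and a y taken by nobody can be removed from `ys`.
  length-≤ : ∀ {xs ys} → Unique xs →
    (∀ {x} → x ∈ xs → ∃[ y ] y ∈ ys × x ∼ y) →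
    (∀ {x x′ y} → x ∈ xs → x′ ∈ xs → x ∼ y → x′ ∼ y → x ≡ x′) →
    length xs ≤ length ys
  length-< : ∀ {xs ys y} → Unique xs → y ∈ ys → (∀ {x} → x ∈ xs → ¬ (x ∼ y)) →
    (∀ {x} → x ∈ xs → ∃[ y ] y ∈ ys × x ∼ y) →
    (∀ {x x′ y} → x ∈ xs → x′ ∈ xs → x ∼ y → x′ ∼ y → x ≡ x′) →
    length xs < length ys

  length-≤ [] total injective = z≤n
  length-≤ (x≢ ∷ uniq) total injective with total (here refl)
  ... | y , y∈ys , x∼y = length-< uniq y∈ys
    (λ x′∈ x′∼y → All.lookup x≢ x′∈ (injective (here refl) (there x′∈) x∼y x′∼y))
    (total ∘ there) (λ x∈ x′∈ → injective (there x∈) (there x′∈))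

  length-< {xs} {y = y} uniq y∈ys missed total injective with ∈-∃++ y∈ys
  ... | ys₁ , ys₂ , refl = subst (length xs <_)
    (sym (trans (length-++ ys₁) (+-suc (length ys₁) (length ys₂))))
    (s≤s (subst (length xs ≤_) (length-++ ys₁) (length-≤ uniq total′ injective)))
    where
    total′ : ∀ {x} → x ∈ xs → ∃[ y ] y ∈ ys₁ ++ ys₂ × x ∼ y
    total′ x∈ with total x∈
    ... | z , z∈ , x∼z with ∈-++⁻ ys₁ z∈
    ... | inj₁ z∈ys₁ = z , ∈-++⁺ˡ z∈ys₁ , x∼z
    ... | inj₂ (there z∈ys₂) = z , ∈-++⁺ʳ ys₁ z∈ys₂ , x∼z
    ... | inj₂ (here refl) = contradiction x∼z (missed x∈)

∈-allSubsets : (A : Subset n) → A ∈ allSubsets n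
∈-allSubsets []          = here refl
∈-allSubsets (true  ∷ A) = ∈-++⁺ˡ (∈-map⁺ (true ∷_) (∈-allSubsets A))
∈-allSubsets {suc n} (false ∷ A) = ∈-++⁺ʳ (map (true ∷_) (allSubsets n)) (∈-map⁺ (false ∷_) (∈-allSubsets A))

allSubsets-Unique : ∀ n → Unique (allSubsets n)
allSubsets-Unique zero    = [] ∷ []
allSubsets-Unique (suc n) = Unique.++⁺
  (Unique.map⁺ Vec.∷-injectiveʳ (allSubsets-Unique n))
  (Unique.map⁺ Vec.∷-injectiveʳ (allSubsets-Unique n))
  λ (p , q) → let _ , _ , eq = ∈-map⁻ (true ∷_) p ; _ , _ , eq′ = ∈-map⁻ (false ∷_) q in
    contradiction (Vec.∷-injectiveˡ (trans (sym eq) eq′)) λ ()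

-- J′ = J ∖ {max J} and Y = ∁ {max J}.
data MaxRemoved : Subset n → Subset n → Subset n → Set where
  last : ∀ {J Y : Subset n} → J ≡ ⊥ → Y ≡ ⊤ → MaxRemoved (true ∷ J) (false ∷ J) (false ∷ Y)
  next : ∀ {J J′ Y : Subset n} b → MaxRemoved J J′ Y → MaxRemoved (b ∷ J) (b ∷ J′) (true ∷ Y)

MaxRemoved-total : (J : Subset n) → J ≡ ⊥ ⊎ (∃₂ λ J′ Y → MaxRemoved J J′ Y)
MaxRemoved-total [] = inj₁ refl
MaxRemoved-total (b ∷ J) with MaxRemoved-total J
... | inj₂ (J′ , Y , r) = inj₂ (b ∷ J′ , true ∷ Y , next b r)
MaxRemoved-total (true  ∷ J) | inj₁ J≡⊥ = inj₂ (false ∷ J , false ∷ ⊤ , last J≡⊥ refl)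
MaxRemoved-total (false ∷ J) | inj₁ J≡⊥ = inj₁ (cong (false ∷_) J≡⊥)

-- The gap of Y marks the position of the removed maximum.
MaxRemoved-injective : ∀ {J₁ J₂ J′ Y : Subset n} → MaxRemoved J₁ J′ Y → MaxRemoved J₂ J′ Y → J₁ ≡ J₂
MaxRemoved-injective (last _ _) (last _ _) = refl
MaxRemoved-injective (next b r) (next .b s) = cong (b ∷_) (MaxRemoved-injective r s)

MaxRemoved-∣J∣ : ∀ {J J′ Y : Subset n} → MaxRemoved J J′ Y → ∣ J ∣ ≡ suc ∣ J′ ∣
MaxRemoved-∣J∣ (last _ _) = refl
MaxRemoved-∣J∣ (next true  r) = cong suc (MaxRemoved-∣J∣ r)
MaxRemoved-∣J∣ (next false r) = MaxRemoved-∣J∣ r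

MaxRemoved-∣Y∣ : ∀ {J J′ Y : Subset n} → MaxRemoved J J′ Y → suc ∣ Y ∣ ≡ n
MaxRemoved-∣Y∣ (last _ refl) = cong suc (∣⊤∣≡n _)
MaxRemoved-∣Y∣ (next b r) = cong suc (MaxRemoved-∣Y∣ r)

-- X = [t] ∖ {x} stands for A = X ∪ P ∪ Z, where P is the block of length t + 1
-- following [t]. If max J < x, delete J from A. Otherwise delete J ∖ {max J}
-- from [t] and delete from P the elements number x and max J + 1: what is left
-- lies in the shift of A that replaces element number x of P by x.
data Exchange : Subset n → Subset n → Subset n → Subset (suc n) → Set where
  below : ∀ {X J : Subset n} {Y} → X ≡ ⊤ → J ≡ ⊥ → Y ≡ ⊤ → Exchange (false ∷ X) (false ∷ J) (false ∷ X) Y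
  above : ∀ {X : Subset n} {J J′ X′ Y} → X ≡ ⊤ → MaxRemoved J J′ Y → X′ ≡ ∁ J′ →
          Exchange (false ∷ X) J X′ (false ∷ Y)
  next  : ∀ {X J X′ : Subset n} {Y b c} → c ≡ not b → Exchange X J X′ Y →
          Exchange (true ∷ X) (b ∷ J) (c ∷ X′) (true ∷ Y)

Exchange-total : (X J : Subset n) → suc ∣ X ∣ ≡ n → ∃₂ λ X′ Y → Exchange X J X′ Y
Exchange-total (true ∷ X) (b ∷ J) eq with Exchange-total X J (suc-injective eq)
... | X′ , Y , r = not b ∷ X′ , true ∷ Y , next refl r
Exchange-total (false ∷ X) J eq with ∣p∣≡n⇒p≡⊤ (suc-injective eq) | MaxRemoved-total J
... | X≡⊤ | inj₁ refl = false ∷ X , ⊤ , below X≡⊤ refl refl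
... | X≡⊤ | inj₂ (J′ , Y , r) = ∁ J′ , false ∷ Y , above X≡⊤ r refl

-- A full X′ excludes `below`, and under `above` the block Y of length n + 1 has two gaps.
Exchange-⊤ : ∀ {X J X′ : Subset n} {Y} → Exchange X J X′ Y → X′ ≡ ⊤ → ∣ Y ∣ < n
Exchange-⊤ (above _ r _) _ = ≤-reflexive (MaxRemoved-∣Y∣ r)
Exchange-⊤ (next _ r) X′≡⊤ = s≤s (Exchange-⊤ r (Vec.∷-injectiveʳ X′≡⊤))

Exchange-⊤-⊤ : ∀ {X J X′ : Subset n} {Y} → Exchange X J X′ Y → X′ ≡ ⊤ → Y ≢ ⊤
Exchange-⊤-⊤ {n} r X′≡⊤ refl = <⇒≢ (<-trans (Exchange-⊤ r X′≡⊤) (n<1+n n)) (∣⊤∣≡n (suc n))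

∁-injective : {A B : Subset n} → ∁ A ≡ ∁ B → A ≡ B
∁-injective {A = []}    {[]}    _  = refl
∁-injective {A = a ∷ A} {b ∷ B} eq =
  cong₂ _∷_ (not-injective (Vec.∷-injectiveˡ eq)) (∁-injective (Vec.∷-injectiveʳ eq))

-- If Y has gaps, the first is at x and the second gives max J; if Y is full, x is the last gap of
-- X′. The remaining gaps of X′ are the other elements of J.
Exchange-injective : ∀ {X₁ J₁ X₂ J₂ X′ : Subset n} {Y} →
  Exchange X₁ J₁ X′ Y → Exchange X₂ J₂ X′ Y → X₁ ≡ X₂ × J₁ ≡ J₂
Exchange-injective (below _ refl _) (below _ refl _) = refl , refl
Exchange-injective (below _ _ ()) (above _ _ _)
Exchange-injective (above _ _ _) (below _ _ ())
Exchange-injective (below X≡⊤ _ Y≡⊤) (next _ r) = contradiction (Vec.∷-injectiveʳ Y≡⊤) (Exchange-⊤-⊤ r X≡⊤)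
Exchange-injective (next _ r) (below X≡⊤ _ Y≡⊤) = contradiction (Vec.∷-injectiveʳ Y≡⊤) (Exchange-⊤-⊤ r X≡⊤)
Exchange-injective (above refl r X′≡) (above refl s X′≡′) with ∁-injective (trans (sym X′≡) X′≡′)
... | refl = refl , MaxRemoved-injective r s
Exchange-injective (next {b = b₁} c≡ r) (next {b = b₂} c≡′ s)
  with not-injective {b₁} {b₂} (trans (sym c≡) c≡′) | Exchange-injective r s
... | refl | refl , refl = refl , refl

∣∁J∣+∣J∣ : (J : Subset n) → ∣ ∁ J ∣ + ∣ J ∣ ≡ n
∣∁J∣+∣J∣ J = trans (cong (_+ ∣ J ∣) (∣∁p∣≡n∸∣p∣ J)) (m∸n+n≡m (∣p∣≤n J))

-- Deleting J from a full prefix would leave the sum at exactly n; here it is one less under `below`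
-- and one more under `above`, which tells `exchange` from `delete`.
Exchange-∣X′∣ : ∀ {X J X′ : Subset n} {Y} → Exchange X J X′ Y →
  suc (∣ X′ ∣ + ∣ J ∣) ≡ n ⊎ ∣ X′ ∣ + ∣ J ∣ ≡ suc n
Exchange-∣X′∣ (below {n} refl refl _) = inj₁ (cong suc (trans (cong₂ _+_ (∣⊤∣≡n n) (∣⊥∣≡0 n)) (+-identityʳ n)))
Exchange-∣X′∣ (above {J′ = J′} _ r refl) =
  inj₂ (trans (cong (∣ ∁ J′ ∣ +_) (MaxRemoved-∣J∣ r)) (trans (+-suc _ _) (cong suc (∣∁J∣+∣J∣ J′))))
Exchange-∣X′∣ (next {b = true} refl r) with Exchange-∣X′∣ r
... | inj₁ eq = inj₁ (cong suc (trans (+-suc _ _) eq))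
... | inj₂ eq = inj₂ (trans (+-suc _ _) (cong suc eq))
Exchange-∣X′∣ (next {b = false} refl r) with Exchange-∣X′∣ r
... | inj₁ eq = inj₁ (cong suc eq)
... | inj₂ eq = inj₂ (cong suc eq)

Exchange-size : ∀ {X J X′ : Subset n} {Y} → Exchange X J X′ Y →
  ∣ X′ ∣ + ∣ Y ∣ + ∣ J ∣ ≡ ∣ X ∣ + suc n
Exchange-size (below {n} refl refl refl) = trans (cong₂ _+_ (cong (∣ ⊤ {n} ∣ +_) (∣⊤∣≡n _)) (∣⊥∣≡0 n)) (+-identityʳ _)
Exchange-size {J = J} (above {n} {J′ = J′} {Y = Y} refl r refl) = begin
  ∣ ∁ J′ ∣ + ∣ Y ∣ + ∣ J ∣       ≡⟨ cong (∣ ∁ J′ ∣ + ∣ Y ∣ +_) (MaxRemoved-∣J∣ r) ⟩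
  ∣ ∁ J′ ∣ + ∣ Y ∣ + suc ∣ J′ ∣  ≡⟨ cong (_+ suc ∣ J′ ∣) (cong (∣ ∁ J′ ∣ +_) (suc-injective (MaxRemoved-∣Y∣ r))) ⟩
  ∣ ∁ J′ ∣ + n + suc ∣ J′ ∣      ≡⟨ cong (_+ suc ∣ J′ ∣) (+-comm ∣ ∁ J′ ∣ n) ⟩
  n + ∣ ∁ J′ ∣ + suc ∣ J′ ∣      ≡⟨ +-assoc n ∣ ∁ J′ ∣ (suc ∣ J′ ∣) ⟩
  n + (∣ ∁ J′ ∣ + suc ∣ J′ ∣)    ≡⟨ cong (n +_) (trans (+-suc _ _) (cong suc (∣∁J∣+∣J∣ J′))) ⟩
  n + suc (suc n)                ≡⟨ cong (_+ suc (suc n)) (sym (∣⊤∣≡n n)) ⟩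
  ∣ ⊤ {n} ∣ + suc (suc n)        ∎
  where open ≡-Reasoning
Exchange-size {X = _ ∷ X} {_ ∷ J} {_ ∷ X′} {_ ∷ Y} (next {n} {b = true} refl r) =
  trans (cong (_+ suc ∣ J ∣) (+-suc ∣ X′ ∣ ∣ Y ∣))
    (trans (cong suc (trans (+-suc _ _) (cong suc (Exchange-size r)))) (sym (cong suc (+-suc _ _))))
Exchange-size {X = _ ∷ X} {_ ∷ J} {_ ∷ X′} {_ ∷ Y} (next {n} {b = false} refl r) =
  cong suc (trans (cong (_+ ∣ J ∣) (+-suc ∣ X′ ∣ ∣ Y ∣))
    (trans (cong suc (Exchange-size r)) (sym (+-suc _ _))))

-- Locates a member containing the image: A itself under `below`, and under `above` the shift of A
-- that fills the gap at x at the cost of one element of the block. The surplus 1 of ⊤ over Y″ meets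
-- the surplus of ⊤ over X in `⊤-Dominates`.
Exchange-cover : ∀ {X J X′ : Subset n} {Y} → Exchange X J X′ Y →
  X′ Subset.⊆ X ⊎ (∃[ Y″ ] Y Subset.⊆ Y″ × Dominates 0 1 Y″ ⊤)
Exchange-cover (below _ _ _) = inj₁ ⊆-refl
Exchange-cover (above _ r _) = inj₂ (false ∷ ⊤ , out⊆ ⊆⊤ , late (Dominates-refl _))
Exchange-cover (next {c = c} _ r) with Exchange-cover r
Exchange-cover (next {c = true}  _ r) | inj₁ ⊆X = inj₁ (in⊆in ⊆X)
Exchange-cover (next {c = false} _ r) | inj₁ ⊆X = inj₁ (out⊆ ⊆X)
... | inj₂ (Y″ , ⊆Y″ , p) = inj₂ (true ∷ Y″ , in⊆in ⊆Y″ , keep true p)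

⊤-Dominates : (X : Subset n) → suc ∣ X ∣ ≡ n → Dominates 1 0 ⊤ X
⊤-Dominates (true  ∷ X) eq = keep true (⊤-Dominates X (suc-injective eq))
⊤-Dominates (false ∷ X) eq with ∣p∣≡n⇒p≡⊤ {p = X} (suc-injective eq)
... | refl = early (Dominates-refl ⊤)

++-⊆ : {A A′ : Subset m} {B B′ : Subset n} → A Subset.⊆ A′ → B Subset.⊆ B′ →
  A Vec.++ B Subset.⊆ A′ Vec.++ B′
++-⊆ {A = []}        {[]}          A⊆ B⊆ = B⊆
++-⊆ {A = false ∷ A} {_ ∷ A′}      A⊆ B⊆ = out⊆ (++-⊆ (drop-∷-⊆ A⊆) B⊆)
++-⊆ {A = true  ∷ A} {true  ∷ A′}  A⊆ B⊆ = in⊆in (++-⊆ (drop-∷-⊆ A⊆) B⊆)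
++-⊆ {A = true  ∷ A} {false ∷ A′}  A⊆ B⊆ = contradiction (A⊆ Vec.here) λ ()

length-cartesianProduct : {A B : Set} (xs : List A) (ys : List B) →
  length (cartesianProduct xs ys) ≡ length xs * length ys
length-cartesianProduct []       ys = refl
length-cartesianProduct (x ∷ xs) ys = trans (length-++ (map (x ,_) ys))
  (cong₂ _+_ (length-map (x ,_) ys) (length-cartesianProduct xs ys))

∣[m]∣ : m ≤ n → ∣ [_] {n} m ∣ ≡ m
∣[m]∣ {zero} {zero}  _         = refl
∣[m]∣ {zero} {suc n} _         = ∣[m]∣ {zero} {n} z≤n
∣[m]∣ (s≤s m≤n) = cong suc (∣[m]∣ m≤n)

[]-mono-⊆ : ∀ {a b} → a ≤ b → [_] {n} a Subset.⊆ [ b ]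
[]-mono-⊆ {zero}  _       = λ ()
[]-mono-⊆ {suc n} {zero} {zero} z≤n = out⊆ ([]-mono-⊆ {n} {zero} {zero} z≤n)
[]-mono-⊆ {suc n} {zero} {suc b} z≤n = out⊆ ([]-mono-⊆ {n} {zero} {b} z≤n)
[]-mono-⊆ {suc n} {suc a} {suc b} (s≤s a≤b) = in⊆in ([]-mono-⊆ {n} {a} {b} a≤b)

rank-[] : ∀ {i} → i ≤ m → i ≤ n → rank i ([_] {n} m) ≡ i
rank-[] z≤n       _         = refl
rank-[] (s≤s i≤m) (s≤s i≤n) = cong suc (rank-[] i≤m i≤n)

-- The injection (A , J) ↦ G from pairs of A ∈ 𝓕 and J ⊆ [t] to the shadow.
data _↘_ {t r} : Subset (t + (suc t + r)) × Subset t → Subset (t + (suc t + r)) → Set where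
  delete   : ∀ {A J G} (Y : Subset (suc t + r)) →
             A ≡ ⊤ Vec.++ Y → G ≡ ∁ J Vec.++ Y → (A , J) ↘ G
  exchange : ∀ {A X J X′ G} {Y : Subset (suc t)} (Z : Subset r) → Exchange X J X′ Y →
             A ≡ X Vec.++ (⊤ Vec.++ Z) → G ≡ X′ Vec.++ (Y Vec.++ Z) → (A , J) ↘ G

delete≢exchange : ∀ {J K X X′ : Subset t} {Y} → ∣ J ∣ ≡ ∣ K ∣ → Exchange X K X′ Y → ∁ J ≢ X′
delete≢exchange {t} {J} {K} ∣J∣≡∣K∣ r refl with Exchange-∣X′∣ r | trans (cong (∣ ∁ J ∣ +_) (sym ∣J∣≡∣K∣)) (∣∁J∣+∣J∣ J)
... | inj₁ 1+s≡t | s≡t = 1+n≢n (trans 1+s≡t (sym s≡t))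
... | inj₂ s≡1+t | s≡t = 1+n≢n (trans (sym s≡1+t) s≡t)

↘-injective : ∀ {A B : Subset (t + (suc t + r))} {J K G} → ∣ J ∣ ≡ ∣ K ∣ →
  (A , J) ↘ G → (B , K) ↘ G → (A , J) ≡ (B , K)
↘-injective {J = J} {K} _ (delete Y refl G≡) (delete Y′ refl G≡′)
  with Vec.++-injective (∁ J) (∁ K) (trans (sym G≡) G≡′)
... | ∁J≡∁K , refl with ∁-injective ∁J≡∁K
... | refl = refl
↘-injective {J = J} eq (delete Y _ G≡) (exchange {X′ = X′} Z r _ G≡′) =
  contradiction (Vec.++-injectiveˡ (∁ J) X′ (trans (sym G≡) G≡′)) (delete≢exchange eq r)
↘-injective {K = K} eq (exchange {X′ = X′} Z r _ G≡) (delete Y _ G≡′) =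
  contradiction (Vec.++-injectiveˡ (∁ K) X′ (trans (sym G≡′) G≡)) (delete≢exchange (sym eq) r)
↘-injective eq (exchange {X′ = X₁} {Y = Y₁} Z₁ r refl G≡) (exchange {X′ = X₂} {Y = Y₂} Z₂ s refl G≡′)
  with Vec.++-injective X₁ X₂ (trans (sym G≡) G≡′)
... | refl , eq′ with Vec.++-injective Y₁ Y₂ eq′
... | refl , refl with Exchange-injective r s
... | refl , refl = refl

↘-total : (A : Subset (t + (suc t + r))) (J : Subset t) → NearStar t A → ∃[ G ] (A , J) ↘ G
↘-total {t} {r} A J near with Vec.splitAt t A
... | X , YZ , refl with Vec.splitAt (suc t) YZ
... | Y , Z , refl with <-cmp (suc ∣ X ∣) t | near
... | tri> _ _ 1+∣X∣>t | _ = _ , delete (Y Vec.++ Z)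
  (cong (Vec._++ (Y Vec.++ Z)) (∣p∣≡n⇒p≡⊤ {p = X} (≤-antisym (∣p∣≤n X) (≤-pred 1+∣X∣>t)))) refl
... | tri< ∣X∣<t _ _ | inj₁ t≤rank = contradiction t≤rank
  (<⇒≱ (<-trans (s≤s (≤-reflexive (rank-++ˡ X (Y Vec.++ Z)))) ∣X∣<t))
... | tri≈ _ 1+∣X∣≡t _ | inj₁ t≤rank = contradiction t≤rank
  (<⇒≱ (≤-trans (s≤s (≤-reflexive (rank-++ˡ X (Y Vec.++ Z)))) (≤-reflexive 1+∣X∣≡t)))
-- Two gaps in [t] are too many for a set with at most one in [2t + 1].
... | tri< ∣X∣<t _ _ | inj₂ 2t≤rank = contradiction
  (≤-trans 2t≤rank (≤-reflexive (trans (rank-++ (suc t) X (Y Vec.++ Z)) (cong (∣ X ∣ +_) (rank-++ˡ Y Z)))))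
  (<⇒≱ (≤-trans (s≤s (+-monoʳ-≤ ∣ X ∣ (∣p∣≤n Y))) (≤-trans (≤-reflexive (cong suc (+-suc ∣ X ∣ t))) (+-monoˡ-≤ t ∣X∣<t))))
-- The single gap allowed already lies in X, so the block Y is full.
... | tri≈ _ 1+∣X∣≡t _ | inj₂ 2t≤rank with Exchange-total X J 1+∣X∣≡t | ∣p∣≡n⇒p≡⊤ {p = Y} (≤-antisym (∣p∣≤n Y) suct≤∣Y∣)
  where
  suct≤∣Y∣ : suc t ≤ ∣ Y ∣
  suct≤∣Y∣ = +-cancelˡ-≤ (∣ X ∣) _ _ (begin
    ∣ X ∣ + suc t                                        ≡⟨ +-suc ∣ X ∣ t ⟩
    suc ∣ X ∣ + t                                        ≡⟨ cong (_+ t) 1+∣X∣≡t ⟩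
    t + t                                                ≤⟨ 2t≤rank ⟩
    rank (t + suc t) (X Vec.++ (Y Vec.++ Z))             ≡⟨ rank-++ (suc t) X (Y Vec.++ Z) ⟩
    ∣ X ∣ + rank (suc t) (Y Vec.++ Z)                    ≡⟨ cong (∣ X ∣ +_) (rank-++ˡ Y Z) ⟩
    ∣ X ∣ + ∣ Y ∣                                        ∎)
    where open ≤-Reasoning
... | X′ , Y′ , r | refl = _ , exchange Z r refl refl

↘-size : ∀ {A G : Subset (t + (suc t + r))} {J} → (A , J) ↘ G → ∣ G ∣ + ∣ J ∣ ≡ ∣ A ∣
↘-size {t} {J = J} (delete Y refl refl) = begin
  ∣ ∁ J Vec.++ Y ∣ + ∣ J ∣     ≡⟨ cong (_+ ∣ J ∣) (trans (∣++∣ (∁ J) Y) (+-comm (∣ ∁ J ∣) (∣ Y ∣))) ⟩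
  ∣ Y ∣ + ∣ ∁ J ∣ + ∣ J ∣      ≡⟨ +-assoc (∣ Y ∣) (∣ ∁ J ∣) (∣ J ∣) ⟩
  ∣ Y ∣ + (∣ ∁ J ∣ + ∣ J ∣)    ≡⟨ cong (∣ Y ∣ +_) (trans (∣∁J∣+∣J∣ J) (sym (∣⊤∣≡n t))) ⟩
  ∣ Y ∣ + ∣ ⊤ {t} ∣            ≡⟨ +-comm ∣ Y ∣ _ ⟩
  ∣ ⊤ {t} ∣ + ∣ Y ∣            ≡⟨ sym (∣++∣ (⊤ {t}) Y) ⟩
  ∣ ⊤ {t} Vec.++ Y ∣           ∎
  where open ≡-Reasoning
↘-size {t} {J = J} (exchange {X = X} {X′ = X′} {Y = Y} Z r refl refl) = begin
  ∣ X′ Vec.++ (Y Vec.++ Z) ∣ + ∣ J ∣    ≡⟨ cong (_+ ∣ J ∣) (trans (∣++∣ X′ _) (cong (∣ X′ ∣ +_) (∣++∣ Y Z))) ⟩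
  ∣ X′ ∣ + (∣ Y ∣ + ∣ Z ∣) + ∣ J ∣      ≡⟨ cong (_+ ∣ J ∣) (trans (sym (+-assoc (∣ X′ ∣) (∣ Y ∣) (∣ Z ∣))) (+-comm _ ∣ Z ∣)) ⟩
  ∣ Z ∣ + (∣ X′ ∣ + ∣ Y ∣) + ∣ J ∣      ≡⟨ +-assoc (∣ Z ∣) _ (∣ J ∣) ⟩
  ∣ Z ∣ + (∣ X′ ∣ + ∣ Y ∣ + ∣ J ∣)      ≡⟨ cong (∣ Z ∣ +_) (trans (Exchange-size r) (cong (∣ X ∣ +_) (sym (∣⊤∣≡n (suc t))))) ⟩
  ∣ Z ∣ + (∣ X ∣ + ∣ ⊤ {suc t} ∣)       ≡⟨ trans (+-comm ∣ Z ∣ _) (+-assoc (∣ X ∣) _ (∣ Z ∣)) ⟩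
  ∣ X ∣ + (∣ ⊤ {suc t} ∣ + ∣ Z ∣)       ≡⟨ sym (trans (∣++∣ X _) (cong (∣ X ∣ +_) (∣++∣ (⊤ {suc t}) Z))) ⟩
  ∣ X Vec.++ (⊤ {suc t} Vec.++ Z) ∣     ∎
  where open ≡-Reasoning

Exchange-∣X∣ : ∀ {X J X′ : Subset n} {Y} → Exchange X J X′ Y → suc ∣ X ∣ ≡ n
Exchange-∣X∣ (below refl _ _) = cong suc (∣⊤∣≡n _)
Exchange-∣X∣ (above refl _ _) = cong suc (∣⊤∣≡n _)
Exchange-∣X∣ (next _ r)       = cong suc (Exchange-∣X∣ r)

↘-cover : ∀ {𝓕 : Family (t + (suc t + r))} {A G J} → Shifted 𝓕 → 𝓕 A → (A , J) ↘ G →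
  ∃[ B ] 𝓕 B × G Subset.⊆ B
↘-cover {t} shifted A∈ (delete {J = J} Y refl refl) = _ , A∈ , ++-⊆ {A = ∁ J} {A′ = ⊤} ⊆⊤ ⊆-refl
↘-cover {t} shifted A∈ (exchange {X′ = X′} {Y = Y} Z r refl refl) with Exchange-cover r
... | inj₁ X′⊆X = _ , A∈ , ++-⊆ X′⊆X (++-⊆ {A = Y} {A′ = ⊤} ⊆⊤ ⊆-refl)
... | inj₂ (Y″ , Y⊆Y″ , dom) = ⊤ Vec.++ (Y″ Vec.++ Z) ,
  shifted (Dominates⇒≺ (Dominates-++ (⊤-Dominates _ (Exchange-∣X∣ r)) (Dominates-++ dom (Dominates-refl Z)))) A∈ ,
  ++-⊆ {A = X′} {A′ = ⊤} ⊆⊤ (++-⊆ Y⊆Y″ ⊆-refl)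

rank-full⇒⊤ : (X : Subset m) (Y : Subset n) → m ≤ rank m (X Vec.++ Y) → X ≡ ⊤
rank-full⇒⊤ X Y m≤rank = ∣p∣≡n⇒p≡⊤ (≤-antisym (∣p∣≤n X) (≤-trans m≤rank (≤-reflexive (rank-++ˡ X Y))))

initial-++ : ∀ {p} (X : Subset m) (Y : Subset n) → m ≤ p → [ p ] ≡ X Vec.++ Y → X ≡ ⊤
initial-++ {m} {n} X Y m≤p [p]≡ = rank-full⇒⊤ X Y
  (≤-reflexive (sym (trans (cong (rank m) (sym [p]≡)) (rank-[] m≤p (m≤m+n m n)))))

-- A deletion leaves a gap in [t]. An exchange that fills [t] has `∣ J ∣` = 1 and two gaps in the
-- block, but then p ≥ 2t, so `[ p ]` has at most one gap there.
↘-misses-initial : ∀ {p} {A : Subset (t + (suc t + r))} {J} → t ≤ p → 1 ≤ ∣ J ∣ → t + suc t ≤ p + ∣ J ∣ →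
  ¬ ((A , J) ↘ [ p ])
↘-misses-initial {t} {J = J} t≤p 1≤∣J∣ _ (delete Y _ [p]≡) = <⇒≢ (m<m+n t 1≤∣J∣) (sym (begin
    t + ∣ J ∣         ≡⟨ cong (_+ ∣ J ∣) (sym (∣⊤∣≡n t)) ⟩
    ∣ ⊤ {t} ∣ + ∣ J ∣ ≡⟨ cong (λ X → ∣ X ∣ + ∣ J ∣) (sym (initial-++ (∁ J) Y t≤p [p]≡)) ⟩
    ∣ ∁ J ∣ + ∣ J ∣   ≡⟨ ∣∁J∣+∣J∣ J ⟩
    t                 ∎))
  where open ≡-Reasoning
↘-misses-initial {t} {r} {p} {J = J} t≤p 1≤∣J∣ bound (exchange {X′ = X′} {Y = Y} Z step _ [p]≡)
  with initial-++ X′ (Y Vec.++ Z) t≤p [p]≡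
... | refl with Exchange-∣X′∣ step
... | inj₁ eq = <⇒≢ (s≤s (m≤m+n t ∣ J ∣)) (sym (trans (cong (λ s → suc (s + ∣ J ∣)) (sym (∣⊤∣≡n t))) eq))
... | inj₂ eq = <⇒≱ (Exchange-⊤ step refl) (+-cancelˡ-≤ t t (∣ Y ∣) (begin
    t + t                                            ≡⟨ sym (rank-[] 2t≤p (+-monoʳ-≤ t (m≤n⇒m≤1+n (m≤m+n t r)))) ⟩
    rank (t + t) ([_] {t + (suc t + r)} p)           ≡⟨ cong (rank (t + t)) [p]≡ ⟩
    rank (t + t) (⊤ {t} Vec.++ (Y Vec.++ Z))         ≡⟨ rank-++ t (⊤ {t}) (Y Vec.++ Z) ⟩
    ∣ ⊤ {t} ∣ + rank t (Y Vec.++ Z)                  ≤⟨ +-mono-≤ (≤-reflexive (∣⊤∣≡n t)) (rank-monoˡ-≤ (Y Vec.++ Z) (n≤1+n t)) ⟩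
    t + rank (suc t) (Y Vec.++ Z)                    ≡⟨ cong (t +_) (rank-++ˡ Y Z) ⟩
    t + ∣ Y ∣                                        ∎))
  where
  open ≤-Reasoning
  ∣J∣≡1 : ∣ J ∣ ≡ 1
  ∣J∣≡1 = +-cancelˡ-≡ t _ _ (trans (cong (_+ ∣ J ∣) (sym (∣⊤∣≡n t))) (trans eq (+-comm 1 t)))
  2t≤p : t + t ≤ p
  2t≤p = ≤-pred (≤-trans (≤-reflexive (sym (+-suc t t)))
    (≤-trans bound (≤-reflexive (trans (cong (p +_) ∣J∣≡1) (+-comm p 1)))))

shadow-bound : ∀ {k} → n ≡ t + (suc t + r) → 1 ≤ j → j ≤ t → t + suc t ≤ k → k ≤ n →
  {𝓕 : Family n} (𝓕? : Decidable 𝓕) → 𝓕 ⊆ binom k → Shifted 𝓕 → (∃[ A ] 𝓕 A) →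
  (∀ {A} → 𝓕 A → NearStar t A) →
  length (filter (λ J → ∣ J ∣ ≟ j) (allSubsets t)) * card 𝓕? < card (∂? k j 𝓕?)
shadow-bound {n} {t} {r} {j} {k} refl 1≤j j≤t 2t<k k≤n {𝓕} 𝓕? uniform shifted (A , A∈) near =
  subst (_< card (∂? k j 𝓕?)) (trans (length-cartesianProduct members deletions) (*-comm (length members) _))
    (length-< _↘_
      (Unique.cartesianProduct⁺ (Unique.filter⁺ 𝓕? (allSubsets-Unique n)) (Unique.filter⁺ (λ J → ∣ J ∣ ≟ j) (allSubsets-Unique t)))
      -- The missed element `[ k ∸ j ]` is in the shadow because 𝓕, being nonempty and shifted,
      -- contains `[ k ]`.
      (∈-∂ (∣[m]∣ (≤-trans (m∸n≤m k j) k≤n))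
           (shifted (Dominates⇒≺ (initial-Dominates k A (trans (+-identityʳ k) (sym (uniform A∈))))) A∈)
           ([]-mono-⊆ (m∸n≤m k j)))
      (λ {(_ , J)} x∈ → ↘-misses-initial {J = J} t≤k∸j
         (≤-trans 1≤j (≤-reflexive (sym (∈⇒∣J∣ x∈))))
         (≤-trans 2t<k (≤-reflexive (trans (sym (m∸n+n≡m j≤k)) (cong (k ∸ j +_) (sym (∈⇒∣J∣ x∈)))))))
      total
      (λ x∈ x′∈ → ↘-injective (trans (∈⇒∣J∣ x∈) (sym (∈⇒∣J∣ x′∈)))))
  where
  members   = filter 𝓕? (allSubsets n)
  deletions = filter (λ J → ∣ J ∣ ≟ j) (allSubsets t)

  ∈⇒∣J∣ : ∀ {B J} → (B , J) ∈ cartesianProduct members deletions → ∣ J ∣ ≡ j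
  ∈⇒∣J∣ x∈ = proj₂ (∈-filter⁻ (λ J → ∣ J ∣ ≟ j) {xs = allSubsets t} (proj₂ (∈-cartesianProduct⁻ members deletions x∈)))

  ∈⇒𝓕 : ∀ {B J} → (B , J) ∈ cartesianProduct members deletions → 𝓕 B
  ∈⇒𝓕 x∈ = proj₂ (∈-filter⁻ 𝓕? {xs = allSubsets n} (proj₁ (∈-cartesianProduct⁻ members deletions x∈)))

  j≤k : j ≤ k
  j≤k = ≤-trans j≤t (≤-trans (m≤m+n t (suc t)) 2t<k)

  t≤k∸j : t ≤ k ∸ j
  t≤k∸j = m+n≤o⇒m≤o∸n t (≤-trans (+-monoʳ-≤ t (m≤n⇒m≤1+n j≤t)) 2t<k)

  ∈-∂ : ∀ {G B} → ∣ G ∣ ≡ k ∸ j → 𝓕 B → G Subset.⊆ B → G ∈ filter (∂? k j 𝓕?) (allSubsets n)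
  ∈-∂ {G} {B} size B∈ G⊆B = ∈-filter⁺ (∂? k j 𝓕?) (∈-allSubsets G) (size , B , B∈ , G⊆B)

  total : ∀ {x} → x ∈ cartesianProduct members deletions →
    ∃[ G ] G ∈ filter (∂? k j 𝓕?) (allSubsets n) × x ↘ G
  total {B , J} x∈ with ↘-total B J (near (∈⇒𝓕 x∈))
  ... | G , step with ↘-cover shifted (∈⇒𝓕 x∈) step
  ... | B′ , B′∈ , G⊆B′ = G , ∈-∂ size B′∈ G⊆B′ , step
    where
    size : ∣ G ∣ ≡ k ∸ j
    size = trans (sym (m+n∸n≡m ∣ G ∣ j)) (cong (_∸ j)
      (trans (cong (∣ G ∣ +_) (sym (∈⇒∣J∣ x∈))) (trans (↘-size step) (uniform (∈⇒𝓕 x∈)))))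

-- Counting

χ : Dec P → ℕ
χ P? = if does P? then 1 else 0

χ-≤ : ∀ {w} (P? : Dec P) → (P → 1 ≤ w) → χ P? ≤ w
χ-≤ (yes p) P⇒1≤w = P⇒1≤w p
χ-≤ (no _)  P⇒1≤w = z≤n

1≤χ : (P? : Dec P) → P → 1 ≤ χ P?
1≤χ (yes _) p = s≤s z≤n
1≤χ (no ¬p) p = contradiction p ¬p

χ-0 : (P? : Dec P) → ¬ P → χ P? ≡ 0
χ-0 (yes p) ¬p = contradiction p ¬p
χ-0 (no _)  _  = refl

∑ₛ : (Subset n → ℕ) → ℕ
∑ₛ {zero}  f = f []
∑ₛ {suc n} f = ∑ₛ (f ∘ (true ∷_)) + ∑ₛ (f ∘ (false ∷_))

length-filter-map : {A B : Set} (f : A → B) {Q : B → Set} (Q? : Decidable Q) (xs : List A) →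
  length (filter Q? (map f xs)) ≡ length (filter (Q? ∘ f) xs)
length-filter-map f Q? []       = refl
length-filter-map f Q? (x ∷ xs) with does (Q? (f x))
... | true  = cong suc (length-filter-map f Q? xs)
... | false = length-filter-map f Q? xs

length-filter≡∑ : {Q : Subset n → Set} (Q? : Decidable Q) →
  length (filter Q? (allSubsets n)) ≡ ∑ₛ (χ ∘ Q?)
length-filter≡∑ {zero} Q? with does (Q? [])
... | true  = refl
... | false = refl
length-filter≡∑ {suc n} Q? = begin
  length (filter Q? (ins ++ outs))                   ≡⟨ cong length (filter-++ Q? ins outs) ⟩
  length (filter Q? ins ++ filter Q? outs)           ≡⟨ length-++ (filter Q? ins) ⟩
  length (filter Q? ins) + length (filter Q? outs)   ≡⟨ cong₂ _+_ (half true) (half false) ⟩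
  ∑ₛ (χ ∘ Q?)                                        ∎
  where
  open ≡-Reasoning
  ins  = map (true ∷_) (allSubsets n)
  outs = map (false ∷_) (allSubsets n)
  half : ∀ b → length (filter Q? (map (b ∷_) (allSubsets n))) ≡ ∑ₛ (χ ∘ Q? ∘ (b ∷_))
  half b = trans (length-filter-map (b ∷_) Q? (allSubsets n)) (length-filter≡∑ (Q? ∘ (b ∷_)))

∑-mono-≤ : {f g : Subset n → ℕ} → (∀ A → f A ≤ g A) → ∑ₛ f ≤ ∑ₛ g
∑-mono-≤ {zero}  f≤g = f≤g []
∑-mono-≤ {suc n} f≤g = +-mono-≤ (∑-mono-≤ (f≤g ∘ (true ∷_))) (∑-mono-≤ (f≤g ∘ (false ∷_)))

∑-zero : {f : Subset n → ℕ} → (∀ A → f A ≡ 0) → ∑ₛ f ≡ 0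
∑-zero {zero}  f≡0 = f≡0 []
∑-zero {suc n} f≡0 = cong₂ _+_ (∑-zero (f≡0 ∘ (true ∷_))) (∑-zero (f≡0 ∘ (false ∷_)))

∑-+ : (f g : Subset n → ℕ) → ∑ₛ (λ A → f A + g A) ≡ ∑ₛ f + ∑ₛ g
∑-+ {zero}  f g = refl
∑-+ {suc n} f g = trans
  (cong₂ _+_ (∑-+ (f ∘ (true ∷_)) (g ∘ (true ∷_))) (∑-+ (f ∘ (false ∷_)) (g ∘ (false ∷_))))
  (interchange +-commutativeSemigroup (∑ₛ (f ∘ (true ∷_))) (∑ₛ (g ∘ (true ∷_))) (∑ₛ (f ∘ (false ∷_))) (∑ₛ (g ∘ (false ∷_))))

∑-* : ∀ c (f : Subset n → ℕ) → ∑ₛ (λ A → c * f A) ≡ c * ∑ₛ f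
∑-* {zero}  c f = refl
∑-* {suc n} c f = trans (cong₂ _+_ (∑-* c (f ∘ (true ∷_))) (∑-* c (f ∘ (false ∷_)))) (sym (*-distribˡ-+ c _ _))

∑-sum : {I : Set} (f : I → Subset n → ℕ) (is : List I) →
  ∑ₛ (λ A → sum (map (λ i → f i A) is)) ≡ sum (map (λ i → ∑ₛ (f i)) is)
∑-sum {n} f []   = ∑-zero {n} (λ _ → refl)
∑-sum f (i ∷ is) = trans (∑-+ (f i) (λ A → sum (map (λ i → f i A) is))) (cong (∑ₛ (f i) +_) (∑-sum f is))

-- Allows the traces on an initial segment to be counted separately from the rest.
∑-++-≤ : {f : Subset (m + n) → ℕ} {g : Subset m → ℕ} {h : Subset n → ℕ} →
  (∀ X Z → f (X Vec.++ Z) ≤ g X * h Z) → ∑ₛ f ≤ ∑ₛ g * ∑ₛ h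
∑-++-≤ {zero} {g = g} {h} f≤ = ≤-trans (∑-mono-≤ (f≤ [])) (≤-reflexive (∑-* (g []) h))
∑-++-≤ {suc m} {g = g} {h} f≤ = ≤-trans
  (+-mono-≤ (∑-++-≤ (f≤ ∘ (true ∷_))) (∑-++-≤ (f≤ ∘ (false ∷_))))
  (≤-reflexive (sym (*-distribʳ-+ (∑ₛ h) (∑ₛ (g ∘ (true ∷_))) (∑ₛ (g ∘ (false ∷_))))))

∑-binom : ∀ n k → ∑ₛ {n} (λ A → χ (∣ A ∣ ≟ k)) ≡ n C k
∑-binom zero    zero    = refl
∑-binom zero    (suc k) = refl
∑-binom (suc n) zero    = cong₂ _+_ (∑-zero {n} (λ _ → refl)) (∑-binom n zero)
∑-binom (suc n) (suc k) = trans (cong₂ _+_ (∑-binom n k) (∑-binom n (suc k))) (nCk+nC[k+1]≡[n+1]C[k+1] n k)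

C-monoˡ-≤ : ∀ m n k → n C k ≤ (m + n) C k
C-monoˡ-≤ zero    n k = ≤-refl
C-monoˡ-≤ (suc m) n k = ≤-trans (C-monoˡ-≤ m n k) (C-suc k)
  where
  C-suc : ∀ k → (m + n) C k ≤ suc (m + n) C k
  C-suc zero    = ≤-refl
  C-suc (suc k) = ≤-trans (m≤n+m _ ((m + n) C k)) (≤-reflexive (nCk+nC[k+1]≡[n+1]C[k+1] (m + n) k))

-- 1 if the walk stepping up at the elements of A and down elsewhere reaches height d, else 0.
reaches : ℕ → Subset n → ℕ
reaches zero    A           = 1
reaches (suc d) []          = 0
reaches (suc d) (true  ∷ A) = reaches d A
reaches (suc d) (false ∷ A) = reaches (suc (suc d)) A

-- For i ≤ n the walk is at height 2 `rank i A` - i after i steps; since its steps are ±1, it cannot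
-- get to d or above without visiting d.
reaches-1 : ∀ i d (A : Subset n) → i + d ≤ rank i A + rank i A → 1 ≤ reaches d A
reaches-1 i       zero    A  _ = ≤-refl
reaches-1 zero    (suc d) A  ()
reaches-1 (suc i) (suc d) [] ()
reaches-1 (suc i) (suc d) (true ∷ A) high = reaches-1 i d A
  (≤-pred (≤-pred (≤-trans (≤-reflexive (cong suc (sym (+-suc i d)))) (≤-trans high (≤-reflexive (cong suc (+-suc _ _)))))))
reaches-1 (suc i) (suc d) (false ∷ A) high = reaches-1 i (suc (suc d)) A (≤-trans (≤-reflexive (+-suc i (suc d))) high)

reaches-0 : ∀ d (A : Subset n) → ∣ A ∣ < d → reaches d A ≡ 0
reaches-0 (suc d) []          _       = refl
reaches-0 (suc d) (true  ∷ A) (s≤s p) = reaches-0 d A p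
reaches-0 (suc d) (false ∷ A) p       = reaches-0 (suc (suc d)) A (m≤n⇒m≤1+n p)

-- The reflection principle; its induction step is Pascal's rule.
reflection : ∀ n d k → ∑ₛ {n} (λ A → reaches d A * χ (∣ A ∣ ≟ d + k)) ≤ n C k
reflection n       zero    k = ≤-trans (∑-mono-≤ {n} (λ A → ≤-reflexive (+-identityʳ _))) (≤-reflexive (∑-binom n k))
reflection zero    (suc d) k = z≤n
-- With k = 0 a first step down is fatal: d + 2 up steps would be needed, and only d + 1 are
-- available.
reflection (suc n) (suc d) zero = ≤-trans (+-mono-≤ (reflection n d 0) (≤-reflexive (∑-zero {n} unreached)))
  (≤-reflexive (+-identityʳ 1))
  where
  unreached : ∀ A → reaches (suc (suc d)) A * χ (∣ A ∣ ≟ suc d + 0) ≡ 0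
  unreached A with ∣ A ∣ <? suc (suc d)
  ... | yes short = cong (_* χ (∣ A ∣ ≟ suc d + 0)) (reaches-0 (suc (suc d)) A short)
  ... | no  long  = trans (cong (reaches (suc (suc d)) A *_) (χ-0 (∣ A ∣ ≟ suc d + 0)
    λ eq → long (s≤s (≤-reflexive (trans eq (+-identityʳ _)))))) (*-zeroʳ (reaches (suc (suc d)) A))
-- A step up lowers the target and the size alike; a step down raises the target to d + 2, and the
-- size is rewritten as (d + 2) + k.
reflection (suc n) (suc d) (suc k) = ≤-trans
  (+-mono-≤ (reflection n d (suc k))
    (subst (λ l → ∑ₛ {n} (λ A → reaches (suc (suc d)) A * χ (∣ A ∣ ≟ suc l)) ≤ n C k)
      (sym (+-suc d k)) (reflection n (suc (suc d)) k)))
  (≤-reflexive (trans (+-comm (n C suc k) (n C k)) (nCk+nC[k+1]≡[n+1]C[k+1] n k)))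

sum-mono-≤ : {I : Set} {f g : I → ℕ} (is : List I) → (∀ i → f i ≤ g i) → sum (map f is) ≤ sum (map g is)
sum-mono-≤ []       f≤g = z≤n
sum-mono-≤ (i ∷ is) f≤g = +-mono-≤ (f≤g i) (sum-mono-≤ is f≤g)

∈⇒≤sum : {I : Set} (f : I → ℕ) {i : I} {is : List I} → i ∈ is → f i ≤ sum (map f is)
∈⇒≤sum f {is = i ∷ is} (here refl) = m≤m+n (f i) _
∈⇒≤sum f {is = j ∷ is} (there i∈)  = ≤-trans (∈⇒≤sum f i∈) (m≤n+m _ (f j))

-- That is, X = [t] ∪ {c} with t < c ≤ 2t.
NarrowStar : ℕ → Subset n → Set
NarrowStar t X = t ≤ rank t X × suc t ≤ rank (t + t) X × ∣ X ∣ ≤ suc t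

narrowStar? : ∀ t → Decidable (NarrowStar {n} t)
narrowStar? t X = t ≤? rank t X ×-dec suc t ≤? rank (t + t) X ×-dec ∣ X ∣ ≤? suc t

∑-narrowStar : ∀ t q → ∑ₛ {t + (t + q)} (χ ∘ narrowStar? t) ≤ t
∑-narrowStar t q = begin
  ∑ₛ {t + (t + q)} (χ ∘ narrowStar? t)                     ≤⟨ ∑-++-≤ {t} {t + q} split ⟩
  ∑ₛ {t} (λ U → χ (∣ U ∣ ≟ t)) * ∑ₛ {t + q} (χ ∘ single?)  ≤⟨ *-mono-≤ (≤-reflexive (trans (∑-binom t t) (nCn≡1 t))) ∑-single ⟩
  1 * (t * 1)                                              ≡⟨ trans (*-identityˡ _) (*-identityʳ t) ⟩
  t                                                        ∎
  where
  open ≤-Reasoning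
  Single : Subset (t + q) → Set
  Single Y = 1 ≤ rank t Y × ∣ Y ∣ ≤ 1

  single? : Decidable Single
  single? Y = 1 ≤? rank t Y ×-dec ∣ Y ∣ ≤? 1

  split : ∀ U Y → χ (narrowStar? t (U Vec.++ Y)) ≤ χ (∣ U ∣ ≟ t) * χ (single? Y)
  split U Y = χ-≤ (narrowStar? t (U Vec.++ Y)) λ (t≤rank , t<rank , size) →
    let ∣U∣≡t = ≤-antisym (∣p∣≤n U) (≤-trans t≤rank (≤-reflexive (rank-++ˡ U Y)))
        1≤rank = +-cancelˡ-≤ t 1 _ (≤-trans (≤-reflexive (+-comm t 1)) (≤-trans t<rank
                   (≤-reflexive (trans (rank-++ t U Y) (cong (_+ rank t Y) ∣U∣≡t)))))
        ∣Y∣≤1 = +-cancelˡ-≤ t _ 1 (≤-trans (≤-reflexive (sym (trans (∣++∣ U Y) (cong (_+ ∣ Y ∣) ∣U∣≡t))))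
                   (≤-trans size (≤-reflexive (+-comm 1 t))))
    in *-mono-≤ (1≤χ (∣ U ∣ ≟ t) ∣U∣≡t) (1≤χ (single? Y) (1≤rank , ∣Y∣≤1))

  split′ : ∀ V W → χ (single? (V Vec.++ W)) ≤ χ (∣ V ∣ ≟ 1) * χ (∣ W ∣ ≟ 0)
  split′ V W = χ-≤ (single? (V Vec.++ W)) λ (1≤rank , size) →
    let 1≤∣V∣ = ≤-trans 1≤rank (≤-reflexive (rank-++ˡ V W))
        total = ≤-trans (≤-reflexive (sym (∣++∣ V W))) size
        ∣V∣≡1 = ≤-antisym (m+n≤o⇒m≤o (∣ V ∣) total) 1≤∣V∣
        ∣W∣≡0 = n≤0⇒n≡0 (≤-pred (≤-trans (+-monoˡ-≤ (∣ W ∣) 1≤∣V∣) total))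
    in *-mono-≤ (1≤χ (∣ V ∣ ≟ 1) ∣V∣≡1) (1≤χ (∣ W ∣ ≟ 0) ∣W∣≡0)

  ∑-single : ∑ₛ {t + q} (χ ∘ single?) ≤ t * 1
  ∑-single = ≤-trans (∑-++-≤ {t} {q} split′)
    (≤-reflexive (cong₂ _*_ (trans (∑-binom t 1) (nC1≡n t)) (∑-binom q 0)))

-- Members are sorted by the size of their trace on [M]. Light traces are narrow stars, heavy ones
-- are counted by `reflection`, and binomials count the parts outside [M].
card-bound : ∀ {k M} → M ≡ t + (t + q) → n ≡ M + r →
  {𝓕 : Family n} (𝓕? : Decidable 𝓕) → 𝓕 ⊆ binom k →
  (∀ {A} → 𝓕 A → ∃[ i ] i ≤ M × i + t ≤ rank i A + rank i A) →
  (∀ {A} → 𝓕 A → rank M A ≤ suc t → t ≤ rank t A × suc t ≤ rank (t + t) A) →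
  card 𝓕? ≤ t * (r C (k ∸ t ∸ 1)) + ∑[ t + 2 ⋯ k ] (λ ℓ → (M C (ℓ ∸ t)) * (n C (k ∸ ℓ)))
card-bound {t} {q} {n} {r} {k} {M} refl refl {𝓕} 𝓕? uniform high star = begin
  card 𝓕?                                                  ≡⟨ length-filter≡∑ 𝓕? ⟩
  ∑ₛ (χ ∘ 𝓕?)                                              ≤⟨ ∑-mono-≤ classify ⟩
  ∑ₛ (λ A → χ (light? A) + sum (map (λ i → χ (heavy? i A)) levels))
                                                            ≡⟨ ∑-+ (χ ∘ light?) (λ A → sum (map (λ i → χ (heavy? i A)) levels)) ⟩
  ∑ₛ (χ ∘ light?) + ∑ₛ (λ A → sum (map (λ i → χ (heavy? i A)) levels))
                                                            ≡⟨ cong (∑ₛ (χ ∘ light?) +_) (∑-sum (λ i A → χ (heavy? i A)) levels) ⟩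
  ∑ₛ (χ ∘ light?) + sum (map (λ i → ∑ₛ (χ ∘ heavy? i)) levels)
                                                            ≤⟨ +-mono-≤ ∑-light (sum-mono-≤ levels ∑-heavy) ⟩
  t * (r C (k ∸ t ∸ 1)) + ∑[ t + 2 ⋯ k ] (λ ℓ → (M C (ℓ ∸ t)) * (n C (k ∸ ℓ))) ∎
  where
  open ≤-Reasoning
  -- The index i stands for ℓ = t + 2 + i, as in the definition of `∑[_⋯_]`.
  levels = upTo (suc k ∸ (t + 2))

  light? : ∀ A → Dec (𝓕 A × rank M A ≤ suc t)
  light? A = 𝓕? A ×-dec rank M A ≤? suc t

  heavy? : ∀ i A → Dec (𝓕 A × rank M A ≡ t + 2 + i)
  heavy? i A = 𝓕? A ×-dec rank M A ≟ t + 2 + i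

  classify : ∀ A → χ (𝓕? A) ≤ χ (light? A) + sum (map (λ i → χ (heavy? i A)) levels)
  classify A = χ-≤ (𝓕? A) λ A∈ → case A∈ of-size (rank M A ≤? suc t)
    where
    case_of-size_ : 𝓕 A → Dec (rank M A ≤ suc t) → 1 ≤ χ (light? A) + sum (map (λ i → χ (heavy? i A)) levels)
    case A∈ of-size yes small = ≤-trans (1≤χ (light? A) (A∈ , small)) (m≤m+n _ _)
    case A∈ of-size no  large = ≤-trans (1≤χ (heavy? i A) (A∈ , sym rank≡))
      (≤-trans (∈⇒≤sum (λ i → χ (heavy? i A)) (∈-upTo⁺ i<)) (m≤n+m _ (χ (light? A))))
      where
      t+2≤rank : t + 2 ≤ rank M A
      t+2≤rank = ≤-trans (≤-reflexive (+-comm t 2)) (≰⇒> large)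
      i = rank M A ∸ (t + 2)
      rank≡ : t + 2 + i ≡ rank M A
      rank≡ = m+[n∸m]≡n t+2≤rank
      i< : i < suc k ∸ (t + 2)
      i< = ∸-monoˡ-< (s≤s (≤-trans (rank≤∣A∣ M A) (≤-reflexive (uniform A∈)))) t+2≤rank

  size-Z : ∀ X (Z : Subset r) {l} → 𝓕 (X Vec.++ Z) → ∣ X ∣ ≡ l → ∣ Z ∣ ≡ k ∸ l
  size-Z X Z A∈ refl = trans (sym (m+n∸m≡n (∣ X ∣) _)) (cong (_∸ ∣ X ∣) (trans (sym (∣++∣ X Z)) (uniform A∈)))

  ∑-light : ∑ₛ (χ ∘ light?) ≤ t * (r C (k ∸ t ∸ 1))
  ∑-light = ≤-trans (∑-++-≤ {M} {r} split) (*-mono-≤ (∑-narrowStar t q) (≤-reflexive (∑-binom r (k ∸ t ∸ 1))))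
    where
    split : ∀ X Z → χ (light? (X Vec.++ Z)) ≤ χ (narrowStar? t X) * χ (∣ Z ∣ ≟ k ∸ t ∸ 1)
    split X Z = χ-≤ (light? (X Vec.++ Z)) λ (A∈ , small) →
      let t≤rank , t<rank = star A∈ small
          ∣X∣≤ = ≤-trans (≤-reflexive (sym (rank-++ˡ X Z))) small
          t<rank′ = ≤-trans t<rank (≤-reflexive (rank-++-≤ (+-monoʳ-≤ t (m≤m+n t q)) X Z))
          ∣X∣≡ = ≤-antisym ∣X∣≤ (≤-trans t<rank′ (rank≤∣A∣ (t + t) X))
      in *-mono-≤
        (1≤χ (narrowStar? t X)
          (≤-trans t≤rank (≤-reflexive (rank-++-≤ (m≤m+n t (t + q)) X Z)) , t<rank′ , ∣X∣≤))
        (1≤χ (∣ Z ∣ ≟ k ∸ t ∸ 1) (trans (size-Z X Z A∈ (trans ∣X∣≡ (+-comm 1 t))) (sym (∸-+-assoc k t 1))))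

  ∑-heavy : ∀ i → ∑ₛ (χ ∘ heavy? i) ≤ (M C (t + 2 + i ∸ t)) * (n C (k ∸ (t + 2 + i)))
  ∑-heavy i = ≤-trans (∑-++-≤ {M} {r} split)
    -- The exact count C(r, k - ℓ) outside [M] is enlarged to C(n, k - ℓ).
    (*-mono-≤ (reflection M t (ℓ ∸ t)) (≤-trans (≤-reflexive (∑-binom r (k ∸ ℓ))) (C-monoˡ-≤ M r (k ∸ ℓ))))
    where
    ℓ = t + 2 + i
    t+[ℓ∸t]≡ℓ : t + (ℓ ∸ t) ≡ ℓ
    t+[ℓ∸t]≡ℓ = m+[n∸m]≡n (≤-trans (m≤m+n t 2) (m≤m+n (t + 2) i))
    split : ∀ X Z → χ (heavy? i (X Vec.++ Z)) ≤ (reaches t X * χ (∣ X ∣ ≟ t + (ℓ ∸ t))) * χ (∣ Z ∣ ≟ k ∸ ℓ)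
    split X Z = χ-≤ (heavy? i (X Vec.++ Z)) λ (A∈ , rank≡ℓ) →
      let h , h≤M , meet = high A∈
          ∣X∣≡ℓ = trans (sym (rank-++ˡ X Z)) rank≡ℓ
          rank≡ = rank-++-≤ h≤M X Z
      in *-mono-≤
        (*-mono-≤ (reaches-1 h t X (≤-trans meet (≤-reflexive (cong₂ _+_ rank≡ rank≡))))
                  (1≤χ (∣ X ∣ ≟ t + (ℓ ∸ t)) (trans ∣X∣≡ℓ (sym t+[ℓ∸t]≡ℓ))))
        (1≤χ (∣ Z ∣ ≟ k ∸ ℓ) (size-Z X Z A∈ ∣X∣≡ℓ))

-- The dichotomy on members with a small trace

corollary6p8 : (n k t j : ℕ) →
    n > k → k > t → t > j → j ≥ 1 →
    n ≥ (k ∸ t + 1) * (t + 1) →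
    t + 2 ≤ k ∸ t + 1 →
    (𝓕 : Family n) (𝓕? : Decidable 𝓕) →
    𝓕 ⊆ binom k →
    Shifted 𝓕 →
    Intersecting t 𝓕 →
    ¬ (𝓕 ⊆ 𝓐₁ k t) →
    card 𝓕? > t * ((n + t ∸ 2 * k) C (k ∸ t ∸ 1)) + ∑[ t + 2 ⋯ k ] (λ ℓ → ((2 * k ∸ t) C (ℓ ∸ t)) * (n C (k ∸ ℓ))) →
    card (∂? k j 𝓕?) > (t C j) * card 𝓕?
corollary6p8 n k t j n>k k>t t>j j≥1 n≥ t+2≤ 𝓕 𝓕? uniform shifted intersecting 𝓕⊈𝓐₁ large =
  conclude (anySubset? λ A → 𝓕? A ×-dec rank M A ≤? suc t ×-dec rank (t + t) A ≤? t)
  where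
  M = 2 * k ∸ t
  s = k ∸ t
  p = M ∸ (t + t)

  t+s≡k : t + s ≡ k
  t+s≡k = m+[n∸m]≡n (<⇒≤ k>t)

  1+t≤s : suc t ≤ s
  1+t≤s = +-cancelʳ-≤ 1 (suc t) s (≤-trans (≤-reflexive (sym (+-suc t 1))) t+2≤)

  t≤s : t ≤ s
  t≤s = <⇒≤ 1+t≤s

  2t<k : t + suc t ≤ k
  2t<k = ≤-trans (+-monoʳ-≤ t 1+t≤s) (≤-reflexive t+s≡k)

  M+t≡2k : M + t ≡ 2 * k
  M+t≡2k = m∸n+n≡m (≤-trans (<⇒≤ k>t) (m≤m+n k (k + 0)))

  M≡s+k : M ≡ s + k
  M≡s+k = +-cancelʳ-≡ t M (s + k) (begin
    M + t         ≡⟨ M+t≡2k ⟩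
    k + (k + 0)   ≡⟨ cong (k +_) (trans (+-identityʳ k) (trans (sym t+s≡k) (+-comm t s))) ⟩
    k + (s + t)   ≡⟨ sym (+-assoc k s t) ⟩
    k + s + t     ≡⟨ cong (_+ t) (+-comm k s) ⟩
    s + k + t     ∎)
    where open ≡-Reasoning

  M≤n : M ≤ n
  M≤n = begin
    M                       ≡⟨ trans M≡s+k (cong (s +_) (sym t+s≡k)) ⟩
    s + (t + s)             ≡⟨ trans (cong (s +_) (+-comm t s)) (sym (+-assoc s s t)) ⟩
    s + s + t               ≤⟨ +-mono-≤ (≤-reflexive (cong (s +_) (sym (+-identityʳ s)))) (m≤m+n t 1) ⟩
    -- Here 2 ≤ t + 1, because t > j ≥ 1.
    2 * s + (t + 1)         ≤⟨ +-monoˡ-≤ (t + 1) (*-monoˡ-≤ s (≤-trans (≤-trans (s≤s j≥1) t>j) (m≤m+n t 1))) ⟩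
    (t + 1) * s + (t + 1)   ≡⟨ trans (+-comm ((t + 1) * s) (t + 1)) (trans (sym (*-suc (t + 1) s)) (*-comm (t + 1) (suc s))) ⟩
    suc s * (t + 1)         ≡⟨ cong (_* (t + 1)) (+-comm 1 s) ⟩
    (s + 1) * (t + 1)       ≤⟨ n≥ ⟩
    n                       ∎
    where open ≤-Reasoning

  M≡t+[t+p] : M ≡ t + (t + p)
  M≡t+[t+p] = trans (sym (m+[n∸m]≡n (≤-trans (+-mono-≤ t≤s (<⇒≤ k>t)) (≤-reflexive (sym M≡s+k))))) (+-assoc t t p)

  -- Since M ≤ n, the truncated difference in the assumed bound is the true number of positions
  -- outside [M].
  n≡M+r : n ≡ M + (n + t ∸ 2 * k)
  n≡M+r = begin
    n                          ≡⟨ sym (m+[n∸m]≡n M≤n) ⟩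
    M + (n ∸ M)                ≡⟨ cong (M +_) (sym ([m+n]∸[m+o]≡n∸o t n M)) ⟩
    M + (t + n ∸ (t + M))      ≡⟨ cong (M +_) (cong₂ _∸_ (+-comm t n) (trans (+-comm t M) M+t≡2k)) ⟩
    M + (n + t ∸ 2 * k)        ∎
    where open ≡-Reasoning

  n≡t+[1+t+r] : n ≡ t + (suc t + (n ∸ (t + suc t)))
  n≡t+[1+t+r] = trans (sym (m+[n∸m]≡n (≤-trans 2t<k (<⇒≤ n>k)))) (+-assoc t (suc t) _)

  meet : ∀ {A B} → 𝓕 A → 𝓕 B → ∃[ i ] i + t ≤ rank i A + rank i B
  meet = prefix-intersection t shifted intersecting

  -- Frankl's lemma for A paired with itself: the walk of A gets to height t within [M].
  high : ∀ {A} → 𝓕 A → ∃[ i ] i ≤ M × i + t ≤ rank i A + rank i A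
  high {A} A∈ with meet A∈ A∈
  ... | i , high = i , meeting-point-≤ {t = t} {i} {A} {A} (uniform A∈) (uniform A∈) high , high

  contains-[t] : ∀ {A} → 𝓕 A → rank M A ≤ suc t → t ≤ rank t A
  contains-[t] {A} A∈ short with t ≤? rank t A
  ... | yes t≤rank = t≤rank
  ... | no  t≰rank = ⊥-elim (𝓕⊈𝓐₁ 𝓕⊆𝓐₁)
    where
    𝓕⊆𝓐₁ : 𝓕 ⊆ 𝓐₁ k t
    𝓕⊆𝓐₁ {B} B∈ = uniform B∈ , subst₂ _≤_ (+-comm 1 t)
      (trans (cong (λ i → rank i B) (+-comm 2 t)) (sym (∣A∩[i]∣≡rank (t + 2) B)))
      (short⇒𝓐₁ (uniform A∈) (uniform B∈) short (meet A∈ B∈) (≰⇒> t≰rank))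

  conclude : Dec (∃[ A ] 𝓕 A × rank M A ≤ suc t × rank (t + t) A ≤ t) →
    (t C j) * card 𝓕? < card (∂? k j 𝓕?)
  conclude (yes (A , A∈ , short , rank≤t)) =
    subst (λ c → c * card 𝓕? < card (∂? k j 𝓕?)) (trans (length-filter≡∑ {t} (λ J → ∣ J ∣ ≟ j)) (∑-binom t j))
      (shadow-bound n≡t+[1+t+r] j≥1 (<⇒≤ t>j) 2t<k (<⇒≤ n>k) 𝓕? uniform shifted (A , A∈)
        (λ B∈ → short⇒NearStar (uniform A∈) (uniform B∈) short (meet A∈ B∈) rank≤t))
  -- Negating the existence of A gives every light member at least t + 1 elements in [2t], as
  -- `card-bound` requires.
  conclude (no none) = contradiction
    (card-bound M≡t+[t+p] n≡M+r 𝓕? uniform high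
      (λ A∈ short → contains-[t] A∈ short , ≰⇒> (λ rank≤t → none (_ , A∈ , short , rank≤t))))
    (<⇒≱ large)
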